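{- Let $\Lambda\in\{\mathsf{CS4},\mathsf{IS4},\mathsf{S4I},\mathsf{GS4}\}$ and let $\varphi$ be a formula. (1) If $\Lambda\neq\mathsf{S4I}$ and $\varphi$ is satisfiable (resp. falsifiable) in a shallow $\Lambda$-model, then $\varphi$ is satisfiable (resp. falsifiable) in a $\Lambda$-model with finitely many worlds. (2) If $\Lambda=\mathsf{S4I}$ and $\varphi$ is satisfiable (resp. falsifiable) in a shallow, forest-like $\mathsf{S4I}$-model, then $\varphi$ is satisfiable (resp. falsifiable) in an $\mathsf{S4I}$-model with finitely many worlds.
   Context: Formulas over a countably infinite set $\mathbb P$ of variables: $p\mid\bot\mid\varphi\wedge\psi\mid\varphi\vee\psi\mid\varphi\to\psi\mid\Diamond\varphi\mid\Box\varphi$. A bi-intuitionistic frame is $(W,W_\bot,\preccurlyeq,\sqsubseteq)$ with $\preccurlyeq,\sqsubseteq$ preorders on $W$ and $W_\bot\subseteq W$ upward closed under both; infallible if $W_\bot=\varnothing$. A valuation $V:\mathbb P\to 2^W$ has each $V(p)$ upward closed under $\preccurlyeq$ and containing $W_\bot$; a model is $\mathcal M=(W,W_\bot,\preccurlyeq,\sqsubseteq,V)$. Satisfaction: $p$ iff $w\in V(p)$; $\bot$ iff $w\in W_\bot$; $\wedge,\vee$ pointwise; $w\models\varphi\to\psi$ iff for all $v\succcurlyeq w$, $v\models\varphi$ implies $v\models\psi$; $w\models\Diamond\varphi$ iff for all $u\succcurlyeq w$ there is $v\sqsupseteq u$ with $v\models\varphi$; $w\models\Box\varphi$ iff $v\models\varphi$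 whenever $w\preccurlyeq u\sqsubseteq v$. $\varphi$ is satisfiable (falsifiable) in $\mathcal M$ if $(\mathcal M,w)\models\varphi$ (resp. $\not\models$) for some $w\in W\setminus W_\bot$. $\sqsubseteq$ is forward confluent if $w\preccurlyeq w'$, $w\sqsubseteq v$ imply some $v'$ with $v\preccurlyeq v'$, $w'\sqsubseteq v'$; backward confluent if $w\sqsubseteq v\preccurlyeq v'$ implies some $w'$ with $w\preccurlyeq w'\sqsubseteq v'$; downward confluent if $w\preccurlyeq v\sqsubseteq v'$ implies some $w'$ with $w\sqsubseteq w'\preccurlyeq v'$. Locally linear: $w\preccurlyeq u$, $w\preccurlyeq v$ imply $u\preccurlyeq v$ or $v\preccurlyeq u$. $\mathsf{CS4}$-frames: backward confluent. $\mathsf{IS4}$-frames: infallible, forward and backward confluent. $\mathsf{GS4}$-frames: locally linear $\mathsf{IS4}$-frames. $\mathsf{S4I}$-frames: infallible, forward and downward confluent. A $\Lambda$-model is a model on a $\Lambda$-frame. Write $w\prec v$ if $w\preccurlyeq v$ and $v\not\preccurlyeq w$. The height of $w$ is the supremum of all $n$ for which there is a chain $w=w_0\prec w_1\prec\cdots\prec w_n$; the height of the model is the supremum of the heights of its worlds; the model is shallow if its height is finite. The model is forest-like if for every $w\in W$ the set $\{v\in W: v\preccurlyeq w\}$ is totally ordered by $\preccurlyeq$. -}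

module Defs where

open import Data.Fin.Base using (Fin)
open import Data.Nat.Base using (ℕ; zero; suc; _≤_)
open import Data.Product.Base using (∃-syntax; _×_)
open import Data.Sum.Base using (_⊎_)
open import Function.Bundles using (_↔_)
open import Level using (Level) renaming (suc to lsuc)
open import Relation.Binary.Construct.Add.Supremum.NonStrict _≤_ using (_≤⁺_)
open import Relation.Binary.Core using (Rel)
open import Relation.Binary.Definitions using (_Respects_)
open import Relation.Binary.PropositionalEquality.Core using (_≡_)
open import Relation.Binary.Structures using (IsPreorder)
open import Relation.Nullary.Construct.Add.Supremum using (_⁺; [_])
open import Relation.Nullary.Negation.Core using (¬_)
open import Relation.Unary using (Pred; Empty; _∈_; _∉_; _⊆_)

private
  variable
    ℓ : Level

infixr 7 _∧_
infixr 6 _∨_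
infixr 5 _⇒_
infix  8 ◇_ □_

-- The countably infinite set of propositional variables is ℕ.
data Formula : Set where
  var         : ℕ → Formula
  ⊥′          : Formula
  _∧_ _∨_ _⇒_ : Formula → Formula → Formula
  ◇_ □_       : Formula → Formula

record Frame (ℓ : Level) : Set (lsuc ℓ) where
  infix 4 _≼_ _⊑_ _≺_
  field
    W            : Set ℓ
    W⊥           : Pred W ℓ
    _≼_          : Rel W ℓ
    _⊑_          : Rel W ℓ
    ≼-isPreorder : IsPreorder _≡_ _≼_
    ⊑-isPreorder : IsPreorder _≡_ _⊑_
    W⊥-≼-upward  : W⊥ Respects _≼_
    W⊥-⊑-upward  : W⊥ Respects _⊑_

  _≺_ : Rel W ℓ
  w ≺ v = w ≼ v × ¬ (v ≼ w)

  Infallible : Set ℓ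
  Infallible = Empty W⊥

  ForwardConfluent : Set ℓ
  ForwardConfluent = ∀ {w w′ v} → w ≼ w′ → w ⊑ v → ∃[ v′ ] (v ≼ v′ × w′ ⊑ v′)

  BackwardConfluent : Set ℓ
  BackwardConfluent = ∀ {w v v′} → w ⊑ v → v ≼ v′ → ∃[ w′ ] (w ≼ w′ × w′ ⊑ v′)

  DownwardConfluent : Set ℓ
  DownwardConfluent = ∀ {w v v′} → w ≼ v → v ⊑ v′ → ∃[ w′ ] (w ⊑ w′ × w′ ≼ v′)

  LocallyLinear : Set ℓ
  LocallyLinear = ∀ {w u v} → w ≼ u → w ≼ v → u ≼ v ⊎ v ≼ u

  -- _≼_ is only a preorder, so "totally ordered" means that any two elements
  -- are comparable; antisymmetry is not required.
  ForestLike : Set ℓ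
  ForestLike = ∀ {w u v} → u ≼ w → v ≼ w → u ≼ v ⊎ v ≼ u

  -- Chain w n is the type of chains w = w₀ ≺ w₁ ≺ ⋯ ≺ wₙ.
  data Chain : W → ℕ → Set ℓ where
    stop : ∀ {w} → Chain w zero
    step : ∀ {w v n} → w ≺ v → Chain v n → Chain w (suc n)

  FiniteWorlds : Set ℓ
  FiniteWorlds = ∃[ n ] (W ↔ Fin n)

-- Suprema are taken in ℕ ⁺, which is ℕ with a top element ⊤⁺ (infinity) added.
IsSupremum : Pred (ℕ ⁺) ℓ → ℕ ⁺ → Set ℓ
IsSupremum S s = (∀ x → x ∈ S → x ≤⁺ s) × (∀ b → (∀ x → x ∈ S → x ≤⁺ b) → s ≤⁺ b)

module _ (F : Frame ℓ) where
  open Frame F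

  IsHeight : W → ℕ ⁺ → Set ℓ
  IsHeight w = IsSupremum (λ x → ∃[ n ] (x ≡ [ n ] × Chain w n))

  IsFrameHeight : ℕ ⁺ → Set ℓ
  IsFrameHeight = IsSupremum (λ h → ∃[ w ] IsHeight w h)

  Shallow : Set ℓ
  Shallow = ∃[ n ] IsFrameHeight [ n ]

data Logic : Set where
  CS4 IS4 S4I GS4 : Logic

_-frame : Logic → Frame ℓ → Set ℓ
(CS4 -frame) F = Frame.BackwardConfluent F
(IS4 -frame) F = Frame.Infallible F × Frame.ForwardConfluent F × Frame.BackwardConfluent F
(S4I -frame) F = Frame.Infallible F × Frame.ForwardConfluent F × Frame.DownwardConfluent F
(GS4 -frame) F = Frame.LocallyLinear F × (IS4 -frame) F

record Model (ℓ : Level) : Set (lsuc ℓ) where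
  field
    frame : Frame ℓ
  open Frame frame public
  field
    V          : ℕ → Pred W ℓ
    V-≼-upward : ∀ p → V p Respects _≼_
    W⊥⊆V       : ∀ p → W⊥ ⊆ V p

module _ (M : Model ℓ) where
  open Model M

  infix 4 _⊨_

  _⊨_ : W → Formula → Set ℓ
  w ⊨ var p = w ∈ V p
  w ⊨ ⊥′    = w ∈ W⊥
  w ⊨ φ ∧ ψ = w ⊨ φ × w ⊨ ψ
  w ⊨ φ ∨ ψ = w ⊨ φ ⊎ w ⊨ ψ
  w ⊨ φ ⇒ ψ = ∀ v → w ≼ v → v ⊨ φ → v ⊨ ψ
  w ⊨ ◇ φ   = ∀ u → w ≼ u → ∃[ v ] (u ⊑ v × v ⊨ φ)
  w ⊨ □ φ   = ∀ u v → w ≼ u → u ⊑ v → v ⊨ φ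

  SatisfiableIn : Formula → Set ℓ
  SatisfiableIn φ = ∃[ w ] (w ∉ W⊥ × w ⊨ φ)

  FalsifiableIn : Formula → Set ℓ
  FalsifiableIn φ = ∃[ w ] (w ∉ W⊥ × ¬ (w ⊨ φ))

_-model : Logic → Model ℓ → Set ℓ
(Λ -model) M = (Λ -frame) (Model.frame M)

{-# OPTIONS --safe #-}
module Submission where

-- The finite model is a quotient of the given one, by the kernel of a finite
-- colouring of the worlds that sees the relevant subformulas and is a
-- ≼-bisimulation. In the quotient, ≼ is "below some world of the same colour"
-- and ⊑ is the transitive closure of the image of ⊑; backward or downward
-- confluence carries □ along that closure, and recording whether a world
-- itself has a ⊑-successor satisfying ψ carries ◇ψ.
--
-- In a shallow model, recolouring each world by the set of colours of its
-- immediate ≼-successors becomes stationary after finitely many rounds, which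
-- gives such a colouring. Downward confluence of the quotient needs a bisimulation
-- for ≽ too: starting from the first colouring, refine again along immediate
-- predecessors. In a forest the immediate predecessors of a world form a single
-- ≼-cluster, so the second refinement does not spoil the first.

open import Defs
open import Axiom.ExcludedMiddle using (ExcludedMiddle)
open import Data.Empty using (⊥-elim)
open import Data.Fin.Base using (Fin; zero; suc; combine; funToFin; finToFun)
open import Data.Fin.Properties using (combine-injective; finToFun-funToFin)
open import Data.List.Base using (List; []; _∷_; _++_)
open import Data.List.Relation.Unary.All using (All; []; _∷_)
open import Data.List.Relation.Unary.All.Properties using (++⁻ˡ; ++⁻ʳ)
open import Data.Nat.Base using (ℕ; zero; suc; _≤_; _+_; _^_) renaming (_*_ to _*ℕ_)
open import Data.Nat.Properties using (≤-pred; ≤∧≢⇒<; ≤-trans; 1+n≰n; +-comm; +-suc)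
open import Data.Product.Base using (Σ-syntax; ∃-syntax; _×_; _,_; proj₁; proj₂)
open import Data.Sum.Base using (_⊎_; inj₁; inj₂)
open import Function.Base using (_∘_; flip)
open import Function.Bundles using (_⇔_; mk⇔; Equivalence)
open import Function.Construct.Identity using (↔-id)
open import Level using (Level; 0ℓ)
open import Relation.Binary.Construct.Add.Supremum.NonStrict _≤_ using (_≤⁺_; _≤⊤⁺; [≤]-injective) renaming ([_] to [_]≤)
open import Relation.Binary.Construct.Closure.ReflexiveTransitive using (Star; ε; _◅_; _◅◅_; return; fold; reverse) renaming (map to Star-map)
open import Relation.Binary.Core using (Rel) renaming (_⇒_ to _⇛_)
open import Relation.Binary.PropositionalEquality using (_≡_; _≢_; refl; sym; trans; cong; cong₂; isEquivalence)
open import Relation.Binary.Structures using (IsPreorder)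
open import Relation.Nullary.Construct.Add.Supremum using ([_]; ⊤⁺)
open import Relation.Nullary.Decidable.Core using (yes; no; True; toWitness; fromWitness)
open import Relation.Nullary.Negation.Core using (¬_; contradiction)
open import Relation.Unary using (Pred)

private
  variable
    a ℓ : Level
    A : Set a
    n : ℕ

-- Coded functions and paths of fixed length

funToFin-cong : ∀ {m k} (f g : Fin m → Fin k) → (∀ i → f i ≡ g i) → funToFin f ≡ funToFin g
funToFin-cong {zero}  f g f≗g = refl
funToFin-cong {suc m} f g f≗g =
  cong₂ combine (f≗g zero) (funToFin-cong (f ∘ suc) (g ∘ suc) (f≗g ∘ suc))

-- Unlike `Chain`, a path keeps both endpoints and allows any relation, so it can be reversed and
-- subdivided.
data Path {A : Set a} (R : Rel A ℓ) : ℕ → Rel A (a Level.⊔ ℓ) where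
  []  : ∀ {x} → Path R zero x x
  _∷_ : ∀ {x y z} → R x y → Path R n y z → Path R (suc n) x z

map-path : ∀ {R S : Rel A ℓ} → R ⇛ S → Path R n ⇛ Path S n
map-path f []       = []
map-path f (r ∷ rs) = f r ∷ map-path f rs

snoc : ∀ {R : Rel A ℓ} {x y z} → Path R n x y → R y z → Path R (suc n) x z
snoc []       s = s ∷ []
snoc (r ∷ rs) s = r ∷ snoc rs s

reverse-path : ∀ {R : Rel A ℓ} {x y} → Path (flip R) n x y → Path R n y x
reverse-path []       = []
reverse-path (r ∷ rs) = snoc (reverse-path rs) r

-- Excluding length exactly `n` excludes all greater lengths, since a longer path has an initial
-- segment of length `n`.
Bounded : ∀ {A : Set a} → ℕ → Rel A ℓ → Set (a Level.⊔ ℓ)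
Bounded n R = ∀ {x y} → ¬ Path R n x y

-- Finite colourings

module Colourings (em : ExcludedMiddle ℓ) (W : Set ℓ) where

  bit : Set ℓ → Fin 2
  bit P with em {P}
  ... | yes _ = suc zero
  ... | no  _ = zero

  bit⁺ : ∀ {P Q} → (P → Q) → (Q → P) → bit P ≡ bit Q
  bit⁺ {P} {Q} f g with em {P} | em {Q}
  ... | yes _ | yes _ = refl
  ... | yes p | no ¬q = contradiction (f p) ¬q
  ... | no ¬p | yes q = contradiction (g q) ¬p
  ... | no _  | no _  = refl

  bit⁻ : ∀ P Q → bit P ≡ bit Q → P → Q
  bit⁻ P Q eq p with em {P} | em {Q}
  ... | _     | yes q = q
  bit⁻ P Q () p | yes _ | no _
  ... | no ¬p | no _  = contradiction p ¬p

  record Colouring : Set ℓ where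
    field
      size   : ℕ
      colour : W → Fin size

  open Colouring public

  infix 4 _~[_]_
  _~[_]_ : W → Colouring → W → Set
  w ~[ c ] v = colour c w ≡ colour c v

  trivial : Colouring
  trivial = record { size = 1 ; colour = λ _ → zero }

  splitBy : Pred W ℓ → Colouring
  splitBy P = record { size = 2 ; colour = λ w → bit (P w) }

  infixr 5 _⊗_
  _⊗_ : Colouring → Colouring → Colouring
  c ⊗ d = record { size = size c *ℕ size d ; colour = λ w → combine (colour c w) (colour d w) }

  ⊗⁺ : ∀ c d {w v} → w ~[ c ] v → w ~[ d ] v → w ~[ c ⊗ d ] v
  ⊗⁺ c d = cong₂ combine

  ⊗⁻ : ∀ c d {w v} → w ~[ c ⊗ d ] v → w ~[ c ] v × w ~[ d ] v
  ⊗⁻ c d {w} {v} = combine-injective (colour c w) (colour d w) (colour c v) (colour d v)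

  Invariant : Colouring → Pred W ℓ → Set ℓ
  Invariant c P = ∀ {w v} → w ~[ c ] v → P w → P v

  splitByAll : List (Pred W ℓ) → Colouring
  splitByAll []       = trivial
  splitByAll (P ∷ Ps) = splitBy P ⊗ splitByAll Ps

  splitByAll-invariant : ∀ Ps c → (∀ {w v} → w ~[ c ] v → w ~[ splitByAll Ps ] v) →
                         All (Invariant c) Ps
  splitByAll-invariant []       c c⊆ = []
  splitByAll-invariant (P ∷ Ps) c c⊆ =
    (λ {w} {v} w~v → bit⁻ (P w) (P v) (proj₁ (⊗⁻ (splitBy P) (splitByAll Ps) (c⊆ w~v)))) ∷
    splitByAll-invariant Ps c (λ w~v → proj₂ (⊗⁻ (splitBy P) (splitByAll Ps) (c⊆ w~v)))

  Match : Rel W ℓ → Colouring → Rel W ℓ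
  Match R c w v = ∀ {w′} → R w w′ → ∃[ v′ ] (R v v′ × w′ ~[ c ] v′)

  -- Having equal colours is symmetric, so this one clause contains both halves of the bisimulation
  -- condition.
  Forth : Rel W ℓ → Colouring → Set ℓ
  Forth R c = ∀ {w v} → w ~[ c ] v → Match R c w v

  Sees : Rel W ℓ → (c : Colouring) → W → Fin (size c) → Set ℓ
  Sees R c w i = ∃[ v ] (R w v × colour c v ≡ i)

  -- The set of colours seen from a world is coded by its characteristic function, whence
  -- `2 ^ size c` colours.
  successors : Rel W ℓ → Colouring → Colouring
  successors R c = record { size = 2 ^ size c ; colour = λ w → funToFin (bit ∘ Sees R c w) }

  successors⁺ : ∀ R c {w v} → Match R c w v → Match R c v w → w ~[ successors R c ] v
  successors⁺ R c {w} {v} w→v v→w =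
    funToFin-cong (bit ∘ Sees R c w) (bit ∘ Sees R c v) λ i → bit⁺ (transfer w→v) (transfer v→w)
    where
    transfer : ∀ {x y i} → Match R c x y → Sees R c x i → Sees R c y i
    transfer x→y (u , r , u≡i) = let u′ , r′ , u~u′ = x→y r in u′ , r′ , trans (sym u~u′) u≡i

  successors⁻ : ∀ R c {w v} → w ~[ successors R c ] v → Match R c w v
  successors⁻ R c {w} {v} eq {w′} r =
    let u , r′ , u~w′ = bit⁻ (Sees R c w i) (Sees R c v i) bits (w′ , r , refl) in u , r′ , sym u~w′
    where
    i = colour c w′
    bits : bit (Sees R c w i) ≡ bit (Sees R c v i)
    bits = trans (sym (finToFun-funToFin (bit ∘ Sees R c w) i))
             (trans (cong (λ k → finToFun {2} {size c} k i) eq)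
               (finToFun-funToFin (bit ∘ Sees R c v) i))

  forth-Star : ∀ {R c} → Forth R c → Forth (Star R) c
  forth-Star {c = c} forth w~v ε        = _ , ε , w~v
  forth-Star {c = c} forth w~v (r ◅ rs) =
    let _ , r′  , w₁~v₁ = forth w~v r
        _ , rs′ , w₂~v₂ = forth-Star {c = c} forth w₁~v₁ rs
    in _ , r′ ◅ rs′ , w₂~v₂

  -- A fixed point of "refine by the colours of the R-successors".
  record Refinement (R : Rel W ℓ) (c : Colouring) : Set ℓ where
    field
      refined : Colouring
      finer   : ∀ {w v} → w ~[ refined ] v → w ~[ c ] v
      forth   : Forth R refined
      glue    : ∀ {w v} → w ~[ c ] v → Match R refined w v → Match R refined v w →
                w ~[ refined ] v

    -- `Q`-related worlds have the same `R`-successors. The ends of two matched `Q`-steps therefore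
    -- see the same refined colours because their starting points do, and `glue` applies.
    forth-along : ∀ {Q : Rel W ℓ} → Forth Q c →
                  (∀ {w w′ u} → Q w w′ → R w u → R w′ u) →
                  (∀ {w w′ u} → Q w w′ → R w′ u → R w u) → Forth Q refined
    forth-along forthQ to from w~v q =
      let v′ , q′ , w′~v′ = forthQ (finer w~v) q in
      v′ , q′ , glue w′~v′
        (λ r → let u , s , eq = forth w~v (from q r) in u , to q′ s , eq)
        (λ r → let u , s , eq = forth (sym w~v) (from q′ r) in u , to q s , eq)

  -- Each round looks one `R`-step further; with no path of length `n`, the round after the `n`-th
  -- separates nothing new.
  refine : ∀ n R c → Bounded n R → Refinement R c
  refine n R c bounded = record
    { refined = iter n
    ; finer   = λ w~v → proj₁ (unfold n (stable′ w~v))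
    ; forth   = λ w~v → proj₂ (unfold n (stable′ w~v))
    -- Matching successors gives equality one round later, and later rounds are finer.
    ; glue    = λ w~v m m′ → antitone n (fold′ n w~v m m′)
    }
    where
    iter : ℕ → Colouring
    iter zero    = trivial
    iter (suc k) = c ⊗ successors R (iter k)

    unfold : ∀ k {w v} → w ~[ iter (suc k) ] v → w ~[ c ] v × Match R (iter k) w v
    unfold k w~v =
      let w~v₁ , w~v₂ = ⊗⁻ c (successors R (iter k)) w~v
      in w~v₁ , successors⁻ R (iter k) w~v₂

    fold′ : ∀ k {w v} → w ~[ c ] v → Match R (iter k) w v → Match R (iter k) v w →
            w ~[ iter (suc k) ] v
    fold′ k w~v m m′ = ⊗⁺ c (successors R (iter k)) w~v (successors⁺ R (iter k) m m′)

    antitone : ∀ k {w v} → w ~[ iter (suc k) ] v → w ~[ iter k ] v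
    antitone zero    _   = refl
    antitone (suc k) w~v = fold′ k (proj₁ (unfold (suc k) w~v)) (weaken w~v) (weaken (sym w~v))
      where
      weaken : ∀ {w v} → w ~[ iter (suc (suc k)) ] v → Match R (iter k) w v
      weaken w~v r = let u , s , eq = proj₂ (unfold (suc k) w~v) r in u , s , antitone k eq

    -- Successors of worlds that start no path of length `suc k` start none of length `k`. In the
    -- base case the empty path is a contradiction.
    stable : ∀ k {w v} → (∀ {u} → ¬ Path R k w u) → (∀ {u} → ¬ Path R k v u) →
             w ~[ iter k ] v → w ~[ iter (suc k) ] v
    stable zero    ¬w ¬v _   = ⊥-elim (¬w [])
    stable (suc k) ¬w ¬v w~v =
      fold′ (suc k) (proj₁ (unfold k w~v)) (strengthen ¬w ¬v w~v) (strengthen ¬v ¬w (sym w~v))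
      where
      strengthen : ∀ {w v} → (∀ {u} → ¬ Path R (suc k) w u) → (∀ {u} → ¬ Path R (suc k) v u) →
                   w ~[ iter (suc k) ] v → Match R (iter (suc k)) w v
      strengthen ¬w ¬v w~v r =
        let u , s , eq = proj₂ (unfold k w~v) r
        in u , s , stable k (λ p → ¬w (r ∷ p)) (λ p → ¬v (s ∷ p)) eq

    stable′ : ∀ {w v} → w ~[ iter n ] v → w ~[ iter (suc n) ] v
    stable′ = stable n bounded bounded

-- Clusters and covers

module Shallowness (em : ExcludedMiddle ℓ) (F : Frame ℓ) where
  open Frame F
  open Colourings em W
  open IsPreorder ≼-isPreorder using () renaming (refl to ≼-refl; trans to ≼-trans)

  infix 4 _≈_ _⋖_
  _≈_ _⋖_ : Rel W ℓ
  w ≈ v = w ≼ v × v ≼ w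
  w ⋖ v = w ≺ v × ¬ (∃[ u ] (w ≺ u × u ≺ v))

  -- If the chain lengths are bounded, a downward search from the bound stops at the greatest
  -- attained length, at worst `zero`; otherwise the height is infinite.
  hasHeight : ∀ w → ∃[ h ] IsHeight F w h
  hasHeight w with em {∃[ b ] (∀ n → Chain w n → n ≤ b)}
  ... | yes (b , bound) = least b bound
    where
    least : ∀ b → (∀ n → Chain w n → n ≤ b) → ∃[ h ] IsHeight F w h
    least b bound with em {Chain w b}
    ... | yes c = [ b ] , (λ { _ (n , refl , d) → [ bound n d ]≤ }) ,
                          (λ _ upper → upper [ b ] (b , refl , c))
    least zero    bound | no ¬c = contradiction stop ¬c
    least (suc b) bound | no ¬c =
      least b (λ n d → ≤-pred (≤∧≢⇒< (bound n d) (λ { refl → ¬c d })))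
  ... | no unbounded = ⊤⁺ , (λ x _ → x ≤⊤⁺) , top
    where
    top : ∀ b → (∀ x → ∃[ n ] (x ≡ [ n ] × Chain w n) → x ≤⁺ b) → ⊤⁺ ≤⁺ b
    top ⊤⁺    upper = ⊤⁺ ≤⊤⁺
    top [ b ] upper = contradiction (b , λ n d → [≤]-injective (upper [ n ] (n , refl , d))) unbounded

  -- The frame height bounds only values that are heights; existence of heights brings every chain
  -- under it.
  shallow⇒bounded : Shallow F → ∃[ n ] Bounded n _≺_
  shallow⇒bounded (n , upper , _) = suc n , λ p → 1+n≰n (chain-bound (path⇒chain p))
    where
    path⇒chain : ∀ {k w v} → Path _≺_ k w v → Chain w k
    path⇒chain []       = stop
    path⇒chain (r ∷ rs) = step r (path⇒chain rs)

    chain-bound : ∀ {w k} → Chain w k → k ≤ n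
    chain-bound {w} {k} c with hasHeight w
    ... | h , isH with upper h (w , isH) | proj₁ isH [ k ] (k , refl , c)
    ... | [ h≤n ]≤ | [ k≤h ]≤ = ≤-trans k≤h h≤n

  ≺-≼-trans : ∀ {w v u} → w ≺ v → v ≼ u → w ≺ u
  ≺-≼-trans (w≼v , v⋠w) v≼u = ≼-trans w≼v v≼u , λ u≼w → v⋠w (≼-trans v≼u u≼w)

  ≼-≺-trans : ∀ {w v u} → w ≼ v → v ≺ u → w ≺ u
  ≼-≺-trans w≼v (v≼u , u⋠v) = ≼-trans w≼v v≼u , λ u≼w → u⋠v (≼-trans u≼w w≼v)

  ≈-sym : ∀ {w v} → w ≈ v → v ≈ w
  ≈-sym (p , q) = q , p

  ≈-trans : ∀ {w v u} → w ≈ v → v ≈ u → w ≈ u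
  ≈-trans (p , q) (p′ , q′) = ≼-trans p p′ , ≼-trans q′ q

  ⋖-≈ˡ : ∀ {w w′ u} → w ≈ w′ → w ⋖ u → w′ ⋖ u
  ⋖-≈ˡ (p , q) (w≺u , ¬between) =
    ≼-≺-trans q w≺u , λ (x , w′≺x , x≺u) → ¬between (x , ≼-≺-trans p w′≺x , x≺u)

  ⋖-≈ʳ : ∀ {w w′ u} → w ≈ w′ → u ⋖ w → u ⋖ w′
  ⋖-≈ʳ (p , q) (u≺w , ¬between) =
    ≺-≼-trans u≺w p , λ (x , u≺x , x≺w′) → ¬between (x , u≺x , ≺-≼-trans x≺w′ q)

  -- Two worlds covered by `u` are comparable; if one were strictly below the other, the upper one
  -- would lie strictly between the lower one and `u`.
  forest⇒⋖-unique : ForestLike → ∀ {w v u} → w ⋖ u → v ⋖ u → w ≈ v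
  forest⇒⋖-unique forest {w} {v} w⋖u@((w≼u , _) , ¬between) v⋖u@((v≼u , _) , ¬between′)
    with em {w ≼ v} | em {v ≼ w} | forest w≼u v≼u
  ... | yes p | yes q | _      = p , q
  ... | no ¬p | _     | inj₁ p = contradiction p ¬p
  ... | no ¬p | _     | inj₂ q = contradiction (w , (q , ¬p) , proj₁ w⋖u) ¬between′
  ... | yes _ | no ¬q | inj₂ q = contradiction q ¬q
  ... | yes _ | no ¬q | inj₁ p = contradiction (v , (p , ¬q) , proj₁ v⋖u) ¬between

  -- Generators of `_≼_`: under a bound on strict paths, their reflexive-transitive closure is
  -- `_≼_`.
  data _⇝_ (w v : W) : Set ℓ where
    within : w ≈ v → w ⇝ v
    up     : w ⋖ v → w ⇝ v

  ⇝⇒≼ : _⇝_ ⇛ _≼_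
  ⇝⇒≼ (within (p , _))   = p
  ⇝⇒≼ (up ((p , _) , _)) = p

  -- The first edge that is not a cover, if there is one, is split in two.
  subdivide : ∀ {k w v} → Path _≺_ k w v → Star _⋖_ w v ⊎ Path _≺_ (suc k) w v
  subdivide [] = inj₁ ε
  subdivide (_∷_ {x = w} {y = u} w≺u p) with em {∃[ x ] (w ≺ x × x ≺ u)} | subdivide p
  ... | yes (_ , w≺x , x≺u) | _       = inj₂ (w≺x ∷ x≺u ∷ p)
  ... | no ¬between         | inj₁ s  = inj₁ ((w≺u , ¬between) ◅ s)
  ... | no _                | inj₂ p′ = inj₂ (w≺u ∷ p′)

  module _ {n} (bounded : Bounded n _≺_) where

    -- Each subdivision adds one edge, so the bound forces a stop, and then all edges are covers.
    ≺⇒Star-⋖ : ∀ {w v} → w ≺ v → Star _⋖_ w v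
    ≺⇒Star-⋖ w≺v = go n 1 (+-comm n 1) (w≺v ∷ [])
      where
      go : ∀ fuel k → fuel + k ≡ suc n → ∀ {w v} → Path _≺_ k w v → Star _⋖_ w v
      -- Here the path has length `suc n`, so its tail has the forbidden length `n`.
      go zero       _ refl (_ ∷ p) = ⊥-elim (bounded p)
      go (suc fuel) k eq   p with subdivide p
      ... | inj₁ s  = s
      ... | inj₂ p′ = go fuel (suc k) (trans (+-suc fuel k) eq) p′

    ≼⇒Star-⇝ : _≼_ ⇛ Star _⇝_
    ≼⇒Star-⇝ {w} {v} w≼v with em {v ≼ w}
    ... | yes v≼w = return (within (w≼v , v≼w))
    ... | no  v⋠w = Star-map up (≺⇒Star-⋖ (w≼v , v⋠w))

    Star-⇝⇒≼ : Star _⇝_ ⇛ _≼_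
    Star-⇝⇒≼ = fold _≼_ (λ s → ≼-trans (⇝⇒≼ s)) ≼-refl

    module _ (c : Colouring) (forth-≈ : Forth _≈_ c) where

      -- Matching the generators of `_≼_` one at a time matches `_≼_`.
      forth-≼ : Forth _⋖_ c → Forth _≼_ c
      forth-≼ forth-⋖ w~v w≼w′ =
        let v′ , s , eq = forth-Star {R = _⇝_} {c} forth-⇝ w~v (≼⇒Star-⇝ w≼w′)
        in v′ , Star-⇝⇒≼ s , eq
        where
        forth-⇝ : Forth _⇝_ c
        forth-⇝ w~v (within r) = let v′ , s , eq = forth-≈ w~v r in v′ , within s , eq
        forth-⇝ w~v (up r)     = let v′ , s , eq = forth-⋖ w~v r in v′ , up s , eq

      forth-≽ : Forth (flip _⋖_) c → Forth (flip _≼_) c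
      forth-≽ forth-⋗ w~v w′≼w =
        let v′ , s , eq = forth-Star {R = flip _⇝_} {c} forth-⇜ w~v (reverse (λ r → r) (≼⇒Star-⇝ w′≼w))
        in v′ , Star-⇝⇒≼ (reverse (λ r → r) s) , eq
        where
        forth-⇜ : Forth (flip _⇝_) c
        forth-⇜ w~v (within r) =
          let v′ , s , eq = forth-≈ w~v (≈-sym r) in v′ , within (≈-sym s) , eq
        forth-⇜ w~v (up r) = let v′ , s , eq = forth-⋗ w~v r in v′ , up s , eq

    module _ (c : Colouring) where

      -- Worlds of one cluster may differ in `c`, so the set of colours of the whole cluster is
      -- recorded as well.
      clustered : Colouring
      clustered = c ⊗ successors _≈_ c

      clustered-finer : ∀ {w v} → w ~[ clustered ] v → w ~[ c ] v
      clustered-finer w~v = proj₁ (⊗⁻ c (successors _≈_ c) w~v)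

      -- All members of a cluster see the same set of colours, so only the `c`-colour of the target
      -- has to be matched.
      forth-≈-clustered : Forth _≈_ clustered
      forth-≈-clustered w~v w≈w′ =
        let v′ , v≈v′ , eq = match w~v w≈w′
        in v′ , v≈v′ , ⊗⁺ c (successors _≈_ c) eq (successors⁺ _≈_ c
             (λ r → let u , s , e = match w~v (≈-trans w≈w′ r) in u , ≈-trans (≈-sym v≈v′) s , e)
             (λ r → let u , s , e = match (sym w~v) (≈-trans v≈v′ r) in u , ≈-trans (≈-sym w≈w′) s , e))
        where
        match : ∀ {w v} → w ~[ clustered ] v → Match _≈_ c w v
        match w~v = successors⁻ _≈_ c (proj₂ (⊗⁻ c (successors _≈_ c) w~v))

      module Up = Refinement
        (refine n _⋖_ clustered (λ p → bounded (map-path proj₁ p)))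

      module Down = Refinement
        (refine n (flip _⋖_) Up.refined (λ p → bounded (map-path proj₁ (reverse-path p))))

      -- Members of a cluster have the same upper covers, so this refinement keeps cluster steps
      -- matched.
      forth-≈-up : Forth _≈_ Up.refined
      forth-≈-up = Up.forth-along forth-≈-clustered ⋖-≈ˡ (λ q → ⋖-≈ˡ (≈-sym q))

      forth-≈-down : Forth _≈_ Down.refined
      forth-≈-down = Down.forth-along forth-≈-up ⋖-≈ʳ (λ q → ⋖-≈ʳ (≈-sym q))

      -- `Up` supplies a matching cover `v ⋖ v′`; its end must also agree on the colours of
      -- predecessors. In a forest every predecessor of `w′` lies in the cluster of `w`, and cluster
      -- matching sends it into the cluster of `v`, hence below `v′`.
      forth-⋖-down : ForestLike → Forth _⋖_ Down.refined
      forth-⋖-down forest w~v w⋖w′ =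
        let v′ , v⋖v′ , eq = Up.forth (Down.finer w~v) w⋖w′ in
        v′ , v⋖v′ , Down.glue eq (predecessors w~v w⋖w′ v⋖v′) (predecessors (sym w~v) v⋖v′ w⋖w′)
        where
        predecessors : ∀ {w v w′ v′} → w ~[ Down.refined ] v → w ⋖ w′ → v ⋖ v′ →
                       Match (flip _⋖_) Down.refined w′ v′
        predecessors w~v w⋖w′ v⋖v′ u⋖w′ =
          let x , v≈x , eq = forth-≈-down w~v (forest⇒⋖-unique forest w⋖w′ u⋖w′)
          in x , ⋖-≈ˡ v≈x v⋖v′ , eq

      bisimulation : ∃[ d ] ((∀ {w v} → w ~[ d ] v → w ~[ c ] v) × Forth _≼_ d)
      bisimulation =
        Up.refined , (λ w~v → clustered-finer (Up.finer w~v)) ,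
        forth-≼ Up.refined forth-≈-up Up.forth

      two-way-bisimulation : ForestLike →
        ∃[ d ] ((∀ {w v} → w ~[ d ] v → w ~[ c ] v) × Forth _≼_ d × Forth (flip _≼_) d)
      two-way-bisimulation forest =
        Down.refined , (λ w~v → clustered-finer (Up.finer (Down.finer w~v))) ,
        forth-≼ Down.refined forth-≈-down (forth-⋖-down forest) ,
        forth-≽ Down.refined forth-≈-down Down.forth

-- Semantics

module _ (M : Model ℓ) where
  open Model M
  open IsPreorder ≼-isPreorder using () renaming (trans to ≼-trans)
  open IsPreorder ⊑-isPreorder using () renaming (trans to ⊑-trans)

  ⊨-persistent : ∀ φ {w v} → w ≼ v → _⊨_ M w φ → _⊨_ M v φ
  ⊨-persistent (var p) w≼v s        = V-≼-upward p w≼v s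
  ⊨-persistent ⊥′      w≼v s        = W⊥-≼-upward w≼v s
  ⊨-persistent (φ ∧ ψ) w≼v (s , t)  = ⊨-persistent φ w≼v s , ⊨-persistent ψ w≼v t
  ⊨-persistent (φ ∨ ψ) w≼v (inj₁ s) = inj₁ (⊨-persistent φ w≼v s)
  ⊨-persistent (φ ∨ ψ) w≼v (inj₂ t) = inj₂ (⊨-persistent ψ w≼v t)
  ⊨-persistent (φ ⇒ ψ) w≼v s        = λ u v≼u → s u (≼-trans w≼v v≼u)
  ⊨-persistent (◇ φ)   w≼v s        = λ u v≼u → s u (≼-trans w≼v v≼u)
  ⊨-persistent (□ φ)   w≼v s        = λ u x v≼u → s u x (≼-trans w≼v v≼u)

  -- Backward confluence moves the `_≼_` step before the `_⊑_` steps, which then compose. Downward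
  -- confluence moves it after them, where persistence of `φ` absorbs it.
  □-⊑-persistent : BackwardConfluent ⊎ DownwardConfluent →
                   ∀ φ {w v} → w ⊑ v → _⊨_ M w (□ φ) → _⊨_ M v (□ φ)
  □-⊑-persistent (inj₁ bc) φ w⊑v s u x v≼u u⊑x =
    let w′ , w≼w′ , w′⊑u = bc w⊑v v≼u in s w′ x w≼w′ (⊑-trans w′⊑u u⊑x)
  □-⊑-persistent (inj₂ dc) φ w⊑v s u x v≼u u⊑x =
    let v′ , v⊑v′ , v′≼x = dc v≼u u⊑x
    in ⊨-persistent φ v′≼x (s _ v′ (IsPreorder.refl ≼-isPreorder) (⊑-trans w⊑v v⊑v′))

  -- The predicate for ◇ φ ignores the ≼-successors, so without forward confluence
  -- it differs from ◇ φ and may even vary within a ≼-cluster.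
  observables : Formula → List (Pred W ℓ)
  observables (var p) = V p ∷ []
  observables ⊥′      = []
  observables (φ ∧ ψ) = observables φ ++ observables ψ
  observables (φ ∨ ψ) = observables φ ++ observables ψ
  observables (φ ⇒ ψ) = observables φ ++ observables ψ
  observables (◇ φ)   = (λ w → ∃[ v ] (w ⊑ v × _⊨_ M v φ)) ∷ observables φ
  observables (□ φ)   = (λ w → _⊨_ M w (□ φ)) ∷ observables φ

-- The quotient keeps the carrier W: equally coloured worlds become equivalent
-- for both preorders instead of equal.
module Quotient (em : ExcludedMiddle ℓ) (M : Model ℓ)
                (c : Colourings.Colouring em (Model.W M))
                (forth : Colourings.Forth em (Model.W M) (Model._≼_ M) c)
                (W⊥-invariant : Colourings.Invariant em (Model.W M) c (Model.W⊥ M)) where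
  open Model M
  open Colourings em W
  open IsPreorder ≼-isPreorder using () renaming (refl to ≼-refl; trans to ≼-trans)
  open IsPreorder ⊑-isPreorder using () renaming (refl to ⊑-refl; trans to ⊑-trans)

  infix 4 _≼′_ _⊑₁_
  -- By `forth`, a change of colour can be pushed past `_≼_`, so one on the right suffices and
  -- `_≼′_` is transitive. Nothing similar is assumed for `_⊑_`, hence the two-sided `_⊑₁_` and its
  -- closure.
  _≼′_ _⊑₁_ : Rel W ℓ
  w ≼′ v = ∃[ v′ ] (w ≼ v′ × v′ ~[ c ] v)
  w ⊑₁ v = ∃[ w′ ] ∃[ v′ ] (w ~[ c ] w′ × w′ ⊑ v′ × v′ ~[ c ] v)

  ~⇒≼′ : ∀ {w v} → w ~[ c ] v → w ≼′ v
  ~⇒≼′ w~v = _ , ≼-refl , w~v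

  ~⇒⊑′ : ∀ {w v} → w ~[ c ] v → Star _⊑₁_ w v
  ~⇒⊑′ w~v = return (_ , _ , w~v , ⊑-refl , refl)

  ≼⇒≼′ : ∀ {w v} → w ≼ v → w ≼′ v
  ≼⇒≼′ w≼v = _ , w≼v , refl

  ⊑⇒⊑′ : ∀ {w v} → w ⊑ v → Star _⊑₁_ w v
  ⊑⇒⊑′ w⊑v = return (_ , _ , refl , w⊑v , refl)

  ≼′-trans : ∀ {w v u} → w ≼′ v → v ≼′ u → w ≼′ u
  ≼′-trans (_ , w≼v₁ , v₁~v) (_ , v≼u₁ , u₁~u) =
    let u₂ , v₁≼u₂ , u₁~u₂ = forth (sym v₁~v) v≼u₁
    in u₂ , ≼-trans w≼v₁ v₁≼u₂ , trans (sym u₁~u₂) u₁~u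

  quotient : Model ℓ
  quotient = record
    { frame = record
      { W            = W
      ; W⊥           = W⊥
      ; _≼_          = _≼′_
      ; _⊑_          = Star _⊑₁_
      ; ≼-isPreorder = record
        { isEquivalence = isEquivalence
        ; reflexive     = λ { refl → ~⇒≼′ refl }
        ; trans         = ≼′-trans
        }
      ; ⊑-isPreorder = record
        { isEquivalence = isEquivalence
        ; reflexive     = λ { refl → ε }
        ; trans         = _◅◅_
        }
      ; W⊥-≼-upward  = λ (_ , w≼v , v~u) f → W⊥-invariant v~u (W⊥-≼-upward w≼v f)
      ; W⊥-⊑-upward  = W⊥-⊑₁*-upward
      }
    -- The upward closure of V p agrees with V p whenever c sees p.
    ; V          = λ p w → ∃[ v ] (v ≼′ w × V p v)
    ; V-≼-upward = λ p w≼u (v , v≼w , x) → v , ≼′-trans v≼w w≼u , x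
    ; W⊥⊆V       = λ p {w} f → w , ~⇒≼′ refl , W⊥⊆V p f
    }
    where
    W⊥-⊑₁*-upward : ∀ {w v} → Star _⊑₁_ w v → W⊥ w → W⊥ v
    W⊥-⊑₁*-upward ε f = f
    W⊥-⊑₁*-upward ((_ , _ , p , r , q) ◅ s) f =
      W⊥-⊑₁*-upward s (W⊥-invariant q (W⊥-⊑-upward r (W⊥-invariant p f)))

  module Q = Model quotient

  -- Along the `_⊑₁_` chain, `forth` carries the `_≼_` step across changes of colour and `fc`
  -- carries it across `_⊑_`.
  forward : ForwardConfluent → Q.ForwardConfluent
  forward fc w≼w′ ε = _ , w≼w′ , ε
  forward fc (_ , w≼w₁ , w₁~w′) ((w₀ , v₀ , w~w₀ , w₀⊑v₀ , v₀~v) ◅ s) =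
    let w₂ , w₀≼w₂ , w₁~w₂ = forth w~w₀ w≼w₁
        v₁ , v₀≼v₁ , w₂⊑v₁ = fc w₀≼w₂ w₀⊑v₀
        v₂ , v≼v₂ , v₁~v₂  = forth v₀~v v₀≼v₁
        u , x≼u , s′       = forward fc (≼⇒≼′ v≼v₂) s
    in u , x≼u , (w₂ , v₁ , trans (sym w₁~w′) w₁~w₂ , w₂⊑v₁ , v₁~v₂) ◅ s′

  backward : BackwardConfluent → Q.BackwardConfluent
  backward bc ε v≼v′ = _ , v≼v′ , ε
  backward bc ((w₀ , v₀ , w~w₀ , w₀⊑v₀ , v₀~v) ◅ s) x≼x′ =
    let v′ , (v₁ , v≼v₁ , v₁~v′) , s′ = backward bc s x≼x′
        v₂ , v₀≼v₂ , v₁~v₂ = forth (sym v₀~v) v≼v₁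
        w₁ , w₀≼w₁ , w₁⊑v₂ = bc w₀⊑v₀ v₀≼v₂
        w₂ , w≼w₂ , w₁~w₂  = forth (sym w~w₀) w₀≼w₁
    in w₂ , ≼⇒≼′ w≼w₂ , (w₁ , v₂ , sym w₁~w₂ , w₁⊑v₂ , trans (sym v₁~v₂) v₁~v′) ◅ s′

  -- Here the upper end of the `_≼_` step changes colour first, so the step has to be transported
  -- downwards, which `back` does.
  downward : Forth (flip _≼_) c → DownwardConfluent → Q.DownwardConfluent
  downward back dc w≼v ε = _ , ε , w≼v
  downward back dc (_ , w≼v₁ , v₁~v) ((v₀ , x₀ , v~v₀ , v₀⊑x₀ , x₀~x) ◅ s) =
    let w₀ , w₀≼v₀ , w~w₀ = back (trans v₁~v v~v₀) w≼v₁
        w₁ , w₀⊑w₁ , w₁≼x₀ = dc w₀≼v₀ v₀⊑x₀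
        u , s′ , u≼y = downward back dc (x₀ , w₁≼x₀ , x₀~x) s
    in u , (w₀ , w₁ , w~w₀ , w₀⊑w₁ , refl) ◅ s′ , u≼y

  linear : LocallyLinear → Q.LocallyLinear
  linear ll (u₁ , w≼u₁ , u₁~u) (v₁ , w≼v₁ , v₁~v) with ll w≼u₁ w≼v₁
  ... | inj₁ u₁≼v₁ = inj₁ (≼′-trans (~⇒≼′ (sym u₁~u)) (_ , u₁≼v₁ , v₁~v))
  ... | inj₂ v₁≼u₁ = inj₂ (≼′-trans (~⇒≼′ (sym v₁~v)) (_ , v₁≼u₁ , u₁~u))

  quotient-model : ∀ Λ → (Λ ≡ S4I → Forth (flip _≼_) c) → (Λ -model) M → (Λ -model) quotient
  quotient-model CS4 _    bc                   = backward bc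
  quotient-model IS4 _    (inf , fc , bc)      = inf , forward fc , backward bc
  quotient-model S4I back (inf , fc , dc)      = inf , forward fc , downward (back refl) dc
  quotient-model GS4 _    (ll , inf , fc , bc) = linear ll , inf , forward fc , backward bc

  -- Truth in the quotient

  module Truth (conf : BackwardConfluent ⊎ DownwardConfluent) where

    ⊨-~ : ∀ φ {w v} → w ~[ c ] v → _⊨_ quotient w φ → _⊨_ quotient v φ
    ⊨-~ φ w~v = ⊨-persistent quotient φ (~⇒≼′ w~v)

    -- Working back from `v`, invariance absorbs the changes of colour and transitivity absorbs the
    -- `_⊑_` steps.
    ◇-back : ∀ {φ w v} → Invariant c (λ x → ∃[ y ] (x ⊑ y × _⊨_ M y φ)) →
             Star _⊑₁_ w v → _⊨_ M v φ → ∃[ u ] (w ⊑ u × _⊨_ M u φ)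
    ◇-back inv ε s = _ , ⊑-refl , s
    ◇-back {φ} inv ((_ , _ , p , r , q) ◅ rs) s =
      let u , t , s′ = inv (sym q) (◇-back {φ} inv rs s)
      in inv (sym p) (u , ⊑-trans r t , s′)

    -- Invariance carries `□ φ` across changes of colour, confluence across `_⊑_`.
    □-forward : ∀ {φ w v} → Invariant c (λ x → _⊨_ M x (□ φ)) →
                Star _⊑₁_ w v → _⊨_ M w (□ φ) → _⊨_ M v (□ φ)
    □-forward inv ε s = s
    □-forward {φ} inv ((_ , _ , p , r , q) ◅ rs) s =
      □-forward {φ} inv rs (inv q (□-⊑-persistent M conf φ r (inv p s)))

    mutual
      truth⁺ : ∀ φ → All (Invariant c) (observables M φ) → ∀ {w} → _⊨_ M w φ → _⊨_ quotient w φ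
      truth⁺ (var p) _   {w} s    = w , ~⇒≼′ refl , s
      truth⁺ ⊥′      _   s        = s
      truth⁺ (φ ∧ ψ) inv (s , t)  = truth⁺ φ (++⁻ˡ _ inv) s , truth⁺ ψ (++⁻ʳ (observables M φ) inv) t
      truth⁺ (φ ∨ ψ) inv (inj₁ s) = inj₁ (truth⁺ φ (++⁻ˡ _ inv) s)
      truth⁺ (φ ∨ ψ) inv (inj₂ t) = inj₂ (truth⁺ ψ (++⁻ʳ (observables M φ) inv) t)
      truth⁺ (φ ⇒ ψ) inv s        = λ v (v₁ , w≼v₁ , v₁~v) t →
        ⊨-~ ψ v₁~v (truth⁺ ψ (++⁻ʳ (observables M φ) inv)
          (s v₁ w≼v₁ (truth⁻ φ (++⁻ˡ _ inv) (⊨-~ φ (sym v₁~v) t))))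
      truth⁺ (◇ φ) (_ ∷ inv) s = λ u (u₁ , w≼u₁ , u₁~u) →
        let v , u₁⊑v , t = s u₁ w≼u₁
        in v , (u₁ , v , sym u₁~u , u₁⊑v , refl) ◅ ε , truth⁺ φ inv t
      truth⁺ (□ φ) (inv□ ∷ inv) s = λ u v (u₁ , w≼u₁ , u₁~u) u⊑v →
        -- Once `□ φ` has reached `v`, reflexivity of both preorders yields `φ` there.
        truth⁺ φ inv (□-forward {φ} inv□ u⊑v (inv□ u₁~u (⊨-persistent M (□ φ) w≼u₁ s)) v v ≼-refl ⊑-refl)

      truth⁻ : ∀ φ → All (Invariant c) (observables M φ) → ∀ {w} → _⊨_ quotient w φ → _⊨_ M w φ
      truth⁻ (var p) (inv ∷ _) (v , (v₁ , v≼v₁ , v₁~w) , s) = inv v₁~w (V-≼-upward p v≼v₁ s)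
      truth⁻ ⊥′      _   s        = s
      truth⁻ (φ ∧ ψ) inv (s , t)  = truth⁻ φ (++⁻ˡ _ inv) s , truth⁻ ψ (++⁻ʳ (observables M φ) inv) t
      truth⁻ (φ ∨ ψ) inv (inj₁ s) = inj₁ (truth⁻ φ (++⁻ˡ _ inv) s)
      truth⁻ (φ ∨ ψ) inv (inj₂ t) = inj₂ (truth⁻ ψ (++⁻ʳ (observables M φ) inv) t)
      truth⁻ (φ ⇒ ψ) inv s        = λ v w≼v t →
        truth⁻ ψ (++⁻ʳ (observables M φ) inv) (s v (≼⇒≼′ w≼v) (truth⁺ φ (++⁻ˡ _ inv) t))
      truth⁻ (◇ φ) (inv◇ ∷ inv) s = λ u w≼u →
        let v , u⊑v , t = s u (≼⇒≼′ w≼u) in ◇-back {φ} inv◇ u⊑v (truth⁻ φ inv t)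
      truth⁻ (□ φ) (_ ∷ inv) s = λ u v w≼u u⊑v →
        truth⁻ φ inv (s u v (≼⇒≼′ w≼u) (⊑⇒⊑′ u⊑v))

-- Restriction to finitely many representatives

-- Each world is equivalent to its representative in both preorders, so every witness can be traded
-- for a representative.
module Representatives (em : ExcludedMiddle ℓ) (M : Model ℓ) (m : ℕ)
    (index : Model.W M → Fin m) (rep : Fin m → Model.W M)
    (≼-rep : ∀ w → Model._≼_ M w (rep (index w))) (rep-≼ : ∀ w → Model._≼_ M (rep (index w)) w)
    (⊑-rep : ∀ w → Model._⊑_ M w (rep (index w))) (rep-⊑ : ∀ w → Model._⊑_ M (rep (index w)) w)
    where
  open Model M
  open IsPreorder ≼-isPreorder using () renaming (refl to ≼-refl; trans to ≼-trans)
  open IsPreorder ⊑-isPreorder using () renaming (refl to ⊑-refl; trans to ⊑-trans)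

  -- Excluded middle brings a proposition from level ℓ down to level 0.
  record Small (P : Set ℓ) : Set where
    constructor small
    field holds : True (em {P})

  ↓ : ∀ {P} → P → Small P
  ↓ p = small (fromWitness p)

  ↑ : ∀ {P} → Small P → P
  ↑ (small h) = toWitness h

  restriction : Model 0ℓ
  restriction = record
    { frame = record
      { W            = Fin m
      ; W⊥           = λ i → Small (W⊥ (rep i))
      ; _≼_          = λ i j → Small (rep i ≼ rep j)
      ; _⊑_          = λ i j → Small (rep i ⊑ rep j)
      ; ≼-isPreorder = record
        { isEquivalence = isEquivalence
        ; reflexive     = λ { refl → ↓ ≼-refl }
        ; trans         = λ p q → ↓ (≼-trans (↑ p) (↑ q))
        }
      ; ⊑-isPreorder = record
        { isEquivalence = isEquivalence
        ; reflexive     = λ { refl → ↓ ⊑-refl }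
        ; trans         = λ p q → ↓ (⊑-trans (↑ p) (↑ q))
        }
      ; W⊥-≼-upward  = λ p f → ↓ (W⊥-≼-upward (↑ p) (↑ f))
      ; W⊥-⊑-upward  = λ p f → ↓ (W⊥-⊑-upward (↑ p) (↑ f))
      }
    ; V          = λ p i → Small (V p (rep i))
    ; V-≼-upward = λ p r x → ↓ (V-≼-upward p (↑ r) (↑ x))
    ; W⊥⊆V       = λ p f → ↓ (W⊥⊆V p (↑ f))
    }

  module N = Model restriction

  infallible : Infallible → N.Infallible
  infallible inf i f = inf (rep i) (↑ f)

  forward : ForwardConfluent → N.ForwardConfluent
  forward fc p q = let u , v≼u , w⊑u = fc (↑ p) (↑ q) in
    index u , ↓ (≼-trans v≼u (≼-rep u)) , ↓ (⊑-trans w⊑u (⊑-rep u))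

  backward : BackwardConfluent → N.BackwardConfluent
  backward bc p q = let u , w≼u , u⊑v = bc (↑ p) (↑ q) in
    index u , ↓ (≼-trans w≼u (≼-rep u)) , ↓ (⊑-trans (rep-⊑ u) u⊑v)

  downward : DownwardConfluent → N.DownwardConfluent
  downward dc p q = let u , w⊑u , u≼v = dc (↑ p) (↑ q) in
    index u , ↓ (⊑-trans w⊑u (⊑-rep u)) , ↓ (≼-trans (rep-≼ u) u≼v)

  linear : LocallyLinear → N.LocallyLinear
  linear ll p q with ll (↑ p) (↑ q)
  ... | inj₁ r = inj₁ (↓ r)
  ... | inj₂ r = inj₂ (↓ r)

  restriction-model : ∀ Λ → (Λ -model) M → (Λ -model) restriction
  restriction-model CS4 bc                   = backward bc
  restriction-model IS4 (inf , fc , bc)      = infallible inf , forward fc , backward bc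
  restriction-model S4I (inf , fc , dc)      = infallible inf , forward fc , downward dc
  restriction-model GS4 (ll , inf , fc , bc) =
    linear ll , infallible inf , forward fc , backward bc

  mutual
    truth⁺ : ∀ φ i → _⊨_ M (rep i) φ → _⊨_ restriction i φ
    truth⁺ (var p) i s        = ↓ s
    truth⁺ ⊥′      i s        = ↓ s
    truth⁺ (φ ∧ ψ) i (s , t)  = truth⁺ φ i s , truth⁺ ψ i t
    truth⁺ (φ ∨ ψ) i (inj₁ s) = inj₁ (truth⁺ φ i s)
    truth⁺ (φ ∨ ψ) i (inj₂ t) = inj₂ (truth⁺ ψ i t)
    truth⁺ (φ ⇒ ψ) i s        = λ j p t → truth⁺ ψ j (s (rep j) (↑ p) (truth⁻ φ j t))
    truth⁺ (◇ φ)   i s        = λ j p → let v , j⊑v , t = s (rep j) (↑ p) in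
      index v , ↓ (⊑-trans j⊑v (⊑-rep v)) , truth⁺ φ (index v) (⊨-persistent M φ (≼-rep v) t)
    truth⁺ (□ φ)   i s        = λ j k p q → truth⁺ φ k (s (rep j) (rep k) (↑ p) (↑ q))

    truth⁻ : ∀ φ i → _⊨_ restriction i φ → _⊨_ M (rep i) φ
    truth⁻ (var p) i s        = ↑ s
    truth⁻ ⊥′      i s        = ↑ s
    truth⁻ (φ ∧ ψ) i (s , t)  = truth⁻ φ i s , truth⁻ ψ i t
    truth⁻ (φ ∨ ψ) i (inj₁ s) = inj₁ (truth⁻ φ i s)
    truth⁻ (φ ∨ ψ) i (inj₂ t) = inj₂ (truth⁻ ψ i t)
    truth⁻ (φ ⇒ ψ) i s        = λ v p t → ⊨-persistent M ψ (rep-≼ v)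
      (truth⁻ ψ (index v) (s (index v) (↓ (≼-trans p (≼-rep v)))
        (truth⁺ φ (index v) (⊨-persistent M φ (≼-rep v) t))))
    truth⁻ (◇ φ)   i s        = λ u p →
      let j , q , t = s (index u) (↓ (≼-trans p (≼-rep u)))
      in rep j , ⊑-trans (⊑-rep u) (↑ q) , truth⁻ φ j t
    truth⁻ (□ φ)   i s        = λ u v p q → ⊨-persistent M φ (rep-≼ v)
      (truth⁻ φ (index v) (s (index u) (index v) (↓ (≼-trans p (≼-rep u)))
        (↓ (⊑-trans (rep-⊑ u) (⊑-trans q (⊑-rep v))))))

-- Finite models from shallow models

module _ (em : ExcludedMiddle ℓ) where

  confluence : ∀ Λ (M : Model ℓ) → (Λ -model) M →
               Model.BackwardConfluent M ⊎ Model.DownwardConfluent M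
  confluence CS4 M bc               = inj₁ bc
  confluence IS4 M (_ , _ , bc)     = inj₁ bc
  confluence S4I M (_ , _ , dc)     = inj₂ dc
  confluence GS4 M (_ , _ , _ , bc) = inj₁ bc

  module _ (M : Model ℓ) where
    open Model M
    open Colourings em W
    open Shallowness em frame

    bisimulation-for : ∀ Λ → Shallow frame → (Λ ≡ S4I → ForestLike) → ∀ c →
      ∃[ d ] ((∀ {w v} → w ~[ d ] v → w ~[ c ] v) × Forth _≼_ d × (Λ ≡ S4I → Forth (flip _≼_) d))
    bisimulation-for CS4 shallow _ c =
      let d , finer , forth = bisimulation (proj₂ (shallow⇒bounded shallow)) c
      in d , finer , forth , λ ()
    bisimulation-for IS4 shallow _ c =
      let d , finer , forth = bisimulation (proj₂ (shallow⇒bounded shallow)) c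
      in d , finer , forth , λ ()
    bisimulation-for S4I shallow forest c =
      let d , finer , forth , back =
            two-way-bisimulation (proj₂ (shallow⇒bounded shallow)) c (forest refl)
      in d , finer , forth , λ _ → back
    bisimulation-for GS4 shallow _ c =
      let d , finer , forth = bisimulation (proj₂ (shallow⇒bounded shallow)) c
      in d , finer , forth , λ ()

  -- Equivalences at a single world serve satisfiability in one direction and falsifiability in the
  -- other.
  finite-model : ∀ Λ φ (M : Model ℓ) → (Λ -model) M → Shallow (Model.frame M) →
    (Λ ≡ S4I → Model.ForestLike M) → ∀ w →
    Σ[ N ∈ Model 0ℓ ] ((Λ -model) N × Model.FiniteWorlds N ×
      ∃[ i ] ((Model.W⊥ M w ⇔ Model.W⊥ N i) × (_⊨_ M w φ ⇔ _⊨_ N i φ)))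
  finite-model Λ φ M Λ-M shallow forest w
    with bisimulation-for M Λ shallow forest
           -- `W⊥` is split off too, so that the quotient can keep the same fallible worlds.
           (Colourings.splitByAll em (Model.W M) (Model.W⊥ M ∷ observables M φ))
  ... | c , finer , forth , back
    with Colourings.splitByAll-invariant em (Model.W M) (Model.W⊥ M ∷ observables M φ) c finer
  ... | inv⊥ ∷ inv =
    restriction , restriction-model Λ (quotient-model Λ back Λ-M) , (size c , ↔-id _) ,
    colour c w ,
    mk⇔ (λ f → ↓ (inv⊥ (sym (rep-~ w)) f)) (λ f → inv⊥ (rep-~ w) (↑ f)) ,
    mk⇔ (λ s → R.truth⁺ φ _ (⊨-~ φ (sym (rep-~ w)) (truth⁺ φ inv s)))
        (λ s → truth⁻ φ inv (⊨-~ φ (rep-~ w) (R.truth⁻ φ _ s)))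
    where
    open Colourings em (Model.W M)
    open Quotient em M c forth inv⊥
    open Truth (confluence Λ M Λ-M)

    -- Colours that do not occur are sent to w.
    rep : Fin (size c) → Model.W M
    rep i with em {∃[ v ] colour c v ≡ i}
    ... | yes (v , _) = v
    ... | no _        = w

    rep-~ : ∀ v → rep (colour c v) ~[ c ] v
    rep-~ v with em {∃[ u ] u ~[ c ] v}
    ... | yes (_ , u~v) = u~v
    ... | no ¬∃         = contradiction (v , refl) ¬∃

    module R = Representatives em quotient (size c) (colour c) rep
      (λ v → ~⇒≼′ (sym (rep-~ v))) (λ v → ~⇒≼′ (rep-~ v))
      (λ v → ~⇒⊑′ (sym (rep-~ v))) (λ v → ~⇒⊑′ (rep-~ v))
    open R using (restriction; restriction-model; ↓; ↑)

  finite-satisfiable : ∀ Λ φ (M : Model ℓ) → (Λ -model) M → Shallow (Model.frame M) →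
    (Λ ≡ S4I → Model.ForestLike M) → SatisfiableIn M φ →
    Σ[ N ∈ Model 0ℓ ] ((Λ -model) N × Model.FiniteWorlds N × SatisfiableIn N φ)
  finite-satisfiable Λ φ M Λ-M shallow forest (w , w∉W⊥ , w⊨φ) =
    let N , Λ-N , finite , i , ⊥⇔ , φ⇔ = finite-model Λ φ M Λ-M shallow forest w
    in N , Λ-N , finite , i , w∉W⊥ ∘ Equivalence.from ⊥⇔ , Equivalence.to φ⇔ w⊨φ

  finite-falsifiable : ∀ Λ φ (M : Model ℓ) → (Λ -model) M → Shallow (Model.frame M) →
    (Λ ≡ S4I → Model.ForestLike M) → FalsifiableIn M φ →
    Σ[ N ∈ Model 0ℓ ] ((Λ -model) N × Model.FiniteWorlds N × FalsifiableIn N φ)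
  finite-falsifiable Λ φ M Λ-M shallow forest (w , w∉W⊥ , w⊭φ) =
    let N , Λ-N , finite , i , ⊥⇔ , φ⇔ = finite-model Λ φ M Λ-M shallow forest w
    in N , Λ-N , finite , i , w∉W⊥ ∘ Equivalence.from ⊥⇔ , w⊭φ ∘ Equivalence.from φ⇔

mainTheorem5 : ∀ {ℓ : Level} → ExcludedMiddle ℓ → (Λ : Logic) (φ : Formula) →
    (Λ ≢ S4I →
    ((Σ[ M ∈ Model ℓ ] ((Λ -model) M × Shallow (Model.frame M) × SatisfiableIn M φ)) →
    Σ[ N ∈ Model 0ℓ ] ((Λ -model) N × Model.FiniteWorlds N × SatisfiableIn N φ)) ×
    ((Σ[ M ∈ Model ℓ ] ((Λ -model) M × Shallow (Model.frame M) × FalsifiableIn M φ)) →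
    Σ[ N ∈ Model 0ℓ ] ((Λ -model) N × Model.FiniteWorlds N × FalsifiableIn N φ)))
    ×
    (Λ ≡ S4I →
    ((Σ[ M ∈ Model ℓ ] ((Λ -model) M × Shallow (Model.frame M) × Model.ForestLike M × SatisfiableIn M φ)) →
    Σ[ N ∈ Model 0ℓ ] ((Λ -model) N × Model.FiniteWorlds N × SatisfiableIn N φ)) ×
    ((Σ[ M ∈ Model ℓ ] ((Λ -model) M × Shallow (Model.frame M) × Model.ForestLike M × FalsifiableIn M φ)) →
    Σ[ N ∈ Model 0ℓ ] ((Λ -model) N × Model.FiniteWorlds N × FalsifiableIn N φ)))
mainTheorem5 em Λ φ =
  (λ neq →
    (λ (M , Λ-M , sh , s) → finite-satisfiable em Λ φ M Λ-M sh (λ eq → contradiction eq neq) s) ,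
    (λ (M , Λ-M , sh , s) → finite-falsifiable em Λ φ M Λ-M sh (λ eq → contradiction eq neq) s)) ,
  (λ _ →
    (λ (M , Λ-M , sh , forest , s) → finite-satisfiable em Λ φ M Λ-M sh (λ _ → forest) s) ,
    (λ (M , Λ-M , sh , forest , s) → finite-falsifiable em Λ φ M Λ-M sh (λ _ → forest) s))
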